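{- Let $f:\mathbb{N}\to\mathbb{R}$ be a function with the following property: for every positive integer $h$, every asymptotic basis $A$ with $G(A)\le h$, and every finite subset $X\subseteq A$ such that $A\setminus X$ is an asymptotic basis (i.e. $G(A\setminus X)<\infty$), one has $$G(A\setminus X)\le d(X)\cdot f(h).$$ Then $\liminf_{h\to\infty} f(h)/h^3 \ge 1/27$.
   Context: All sets are sets of integers $A\subseteq\mathbb{Z}$ with $|A\cap\mathbb{Z}_{<0}|<\infty$. Such a set $A$ is an asymptotic basis if for some positive integer $h$ the $h$-fold sumset $hA=\{a_1+\dots+a_h: a_i\in A\}$ contains all but finitely many non-negative integers; the least such $h$ is the order $G(A)$ (and $G(A)=\infty$ if no such $h$ exists). For a finite set $X$ of integers with at least two elements, $\mathrm{diam}(X)=\max X-\min X$, $\delta(X)=\gcd\{x-y: x,y\in X\}$, and $d(X)=\mathrm{diam}(X)/\delta(X)$. -}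

module Defs where

open import Level using (0ℓ)
open import Data.Nat as ℕ using (ℕ; suc)
import Data.Nat.Properties as ℕ
open import Data.Nat.GCD using (gcd; gcd[m,n]≡0⇒m≡0; gcd[m,n]≡0⇒n≡0)
open import Data.Integer as ℤ using (ℤ; 0ℤ)
import Data.Integer.Properties as ℤ
open import Data.Rational as ℚ using (ℚ; Positive; _÷_)
import Data.Rational.Properties as ℚ
open import Data.List using (List; []; _∷_; foldr; cartesianProductWith)
open import Data.List.Extrema ℤ.≤-totalOrder using (max; min; xs≤max; min≤xs; ⊥≤max; min≤⊤)
open import Data.List.NonEmpty using (List⁺; _∷_; toList)
open import Data.List.Relation.Unary.All as List using ()
open import Data.List.Relation.Unary.Any using (here; there)
open import Data.List.Membership.Propositional using () renaming (_∈_ to _∈ₗ_; _∉_ to _∉ₗ_)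
open import Data.List.Membership.Propositional.Properties using (∈-cartesianProductWith⁺)
open import Data.Vec as Vec using (Vec)
open import Data.Vec.Relation.Unary.All as Vec using ()
open import Data.Product using (∃; ∃-syntax; Σ-syntax; _×_; _,_)
open import Data.Sum using (_⊎_; inj₁; inj₂)
open import Relation.Nullary using (¬_; yes; no)
open import Relation.Unary using (Pred; _∈_)
open import Relation.Binary.PropositionalEquality

------------------------------------------------------------------------
-- Real numbers: two-sided, located Dedekind cuts of ℚ

record ℝ : Set₁ where
  field
    lower upper     : Pred ℚ 0ℓ
    lower-inhabited : ∃ lower
    upper-inhabited : ∃ upper
    lower-closed    : ∀ {p r} → p ℚ.< r → lower r → lower p
    upper-closed    : ∀ {p r} → p ℚ.< r → upper p → upper r
    lower-open      : ∀ {p} → lower p → ∃[ r ] p ℚ.< r × lower r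
    upper-open      : ∀ {r} → upper r → ∃[ p ] p ℚ.< r × upper p
    disjoint        : ∀ {p} → lower p → ¬ upper p
    located         : ∀ {p r} → p ℚ.< r → lower p ⊎ upper r

open ℝ

infix 4 _≤ᴿ_

_≤ᴿ_ : ℝ → ℝ → Set
x ≤ᴿ y = ∀ {p} → lower x p → lower y p

fromℚ : ℚ → ℝ
fromℚ q .lower p             = p ℚ.< q
fromℚ q .upper p             = q ℚ.< p
fromℚ q .lower-inhabited     = q ℚ.- ℚ.1ℚ ,
  subst (q ℚ.- ℚ.1ℚ ℚ.<_) (ℚ.+-identityʳ q) (ℚ.+-monoʳ-< q (ℚ.negative⁻¹ (ℚ.- ℚ.1ℚ)))
fromℚ q .upper-inhabited     = q ℚ.+ ℚ.1ℚ ,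
  subst (ℚ._< q ℚ.+ ℚ.1ℚ) (ℚ.+-identityʳ q) (ℚ.+-monoʳ-< q (ℚ.positive⁻¹ ℚ.1ℚ))
fromℚ q .lower-closed        = ℚ.<-trans
fromℚ q .upper-closed p<r q<p = ℚ.<-trans q<p p<r
fromℚ q .lower-open p<q with ℚ.<-dense p<q
... | m , p<m , m<q          = m , p<m , m<q
fromℚ q .upper-open q<r with ℚ.<-dense q<r
... | m , q<m , m<r          = m , m<r , q<m
fromℚ q .disjoint            = ℚ.<-asym
fromℚ q .located {p} {r} p<r with p ℚ.<? q
... | yes p<q                = inj₁ p<q
... | no  p≮q                = inj₂ (ℚ.≤-<-trans (ℚ.≮⇒≥ p≮q) p<r)

fromℕ : ℕ → ℝ
fromℕ n = fromℚ (ℤ.+ n ℚ./ 1)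

record ℚ⁺ : Set where
  constructor mkℚ⁺
  field
    value    : ℚ
    positive : Positive value

-- m / n for natural numbers m, n > 0
ratio : (m n : ℕ) .{{_ : ℕ.NonZero m}} .{{_ : ℕ.NonZero n}} → ℚ⁺
ratio m n = mkℚ⁺ (ℤ.+ m ℚ./ n) (ℚ.normalize-pos m n)

private
  module Scale (q : ℚ) .{{_ : Positive q}} where
    instance
      q≢0 : ℚ.NonZero q
      q≢0 = ℚ.pos⇒nonZero q

      1/q-positive : Positive (ℚ.1/ q)
      1/q-positive = ℚ.1/pos⇒pos q

    ÷-mono : ∀ {p r} → p ℚ.< r → p ÷ q ℚ.< r ÷ q
    ÷-mono = ℚ.*-monoˡ-<-pos (ℚ.1/ q)

    *÷ : ∀ p → (p ℚ.* q) ÷ q ≡ p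
    *÷ p = trans (ℚ.*-assoc p q (ℚ.1/ q))
             (trans (cong (p ℚ.*_) (ℚ.*-inverseʳ q)) (ℚ.*-identityʳ p))

    ÷* : ∀ p → (p ÷ q) ℚ.* q ≡ p
    ÷* p = trans (ℚ.*-assoc p (ℚ.1/ q) q)
             (trans (cong (p ℚ.*_) (ℚ.*-inverseˡ q)) (ℚ.*-identityʳ p))

    mul : ∀ {p r} → p ÷ q ℚ.< r → p ℚ.< r ℚ.* q
    mul {p} {r} h = subst (ℚ._< r ℚ.* q) (÷* p) (ℚ.*-monoˡ-<-pos q h)

    mul′ : ∀ {p r} → r ℚ.< p ÷ q → r ℚ.* q ℚ.< p
    mul′ {p} {r} h = subst (r ℚ.* q ℚ.<_) (÷* p) (ℚ.*-monoˡ-<-pos q h)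

-- Product of a positive rational and a real: p < q x iff p / q < x.

infixr 7 _⋆_

_⋆_ : ℚ⁺ → ℝ → ℝ
mkℚ⁺ q q>0 ⋆ x = λ where
    .lower p → lower x (p ÷ q)
    .upper p → upper x (p ÷ q)
    .lower-inhabited → let p , l = lower-inhabited x in p ℚ.* q , subst (lower x) (sym (*÷ p)) l
    .upper-inhabited → let p , u = upper-inhabited x in p ℚ.* q , subst (upper x) (sym (*÷ p)) u
    .lower-closed p<r → lower-closed x (÷-mono p<r)
    .upper-closed p<r → upper-closed x (÷-mono p<r)
    .lower-open l → let r , p<r , l′ = lower-open x l in
      r ℚ.* q , mul p<r , subst (lower x) (sym (*÷ r)) l′
    .upper-open u → let p , p<r , u′ = upper-open x u in
      p ℚ.* q , mul′ p<r , subst (upper x) (sym (*÷ p)) u′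
    .disjoint → disjoint x
    .located p<r → located x (÷-mono p<r)
  where
  instance _ = q>0
  open Scale q

------------------------------------------------------------------------
-- Extended reals [-∞,+∞] and lim inf
--
-- An extended real is an arbitrary open lower set of rationals: ∅ is -∞ and
-- all of ℚ is +∞.  No locatedness is required, so that arbitrary suprema and
-- infima exist without excluded middle.

record ℝ∞ : Set₁ where
  field
    below        : Pred ℚ 0ℓ
    below-closed : ∀ {p r} → p ℚ.< r → below r → below p
    below-open   : ∀ {p} → below p → ∃[ r ] p ℚ.< r × below r

open ℝ∞

infix 4 _≤∞_

_≤∞_ : ℝ∞ → ℝ∞ → Set
x ≤∞ y = ∀ {p} → below x p → below y p

fromℝ : ℝ → ℝ∞
fromℝ x .below        = lower x
fromℝ x .below-closed = lower-closed x
fromℝ x .below-open   = lower-open x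

sup : {I : Set} → (I → ℝ∞) → ℝ∞
sup x .below p                  = ∃[ i ] below (x i) p
sup x .below-closed p<r (i , b) = i , below-closed (x i) p<r b
sup x .below-open (i , b)       = let r , p<r , b′ = below-open (x i) b in r , p<r , i , b′

-- The intersection of open lower sets need not be open, hence the margin r.

inf : {I : Set} → (I → ℝ∞) → ℝ∞
inf x .below p                        = ∃[ r ] p ℚ.< r × (∀ i → below (x i) r)
inf x .below-closed p<q (r , q<r , b) = r , ℚ.<-trans p<q q<r , b
inf x .below-open (r , p<r , b)       =
  let m , p<m , m<r = ℚ.<-dense p<r in m , p<m , r , m<r , b

liminf : (ℕ → ℝ) → ℝ∞
liminf a = sup λ N → inf {∃[ n ] N ℕ.≤ n} λ (n , _) → fromℝ (a n)

------------------------------------------------------------------------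
-- Asymptotic bases

FinitelyManyNegatives : Pred ℤ 0ℓ → Set
FinitelyManyNegatives A = ∃[ xs ] (∀ {a} → a ∈ A → a ℤ.< 0ℤ → a ∈ₗ xs)

_-foldSumset_ : ℕ → Pred ℤ 0ℓ → Pred ℤ 0ℓ
(h -foldSumset A) n =
  Σ[ as ∈ Vec ℤ h ] Vec.All A as × Vec.foldr′ ℤ._+_ 0ℤ as ≡ n

ContainsAlmostAllNonNegatives : Pred ℤ 0ℓ → Set
ContainsAlmostAllNonNegatives S =
  ∃[ exceptions ] (∀ n → 0ℤ ℤ.≤ n → n ∉ₗ exceptions → n ∈ S)

IsBasisOfOrderAtMost : Pred ℤ 0ℓ → ℕ → Set
IsBasisOfOrderAtMost A h = 0 ℕ.< h × ContainsAlmostAllNonNegatives (h -foldSumset A)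

IsAsymptoticBasis : Pred ℤ 0ℓ → Set
IsAsymptoticBasis A = ∃ (IsBasisOfOrderAtMost A)

-- The graph of G: a relation rather than a function, since finding the least h
-- for an arbitrary A is not computable.  G A ≡ ∞ is ¬ IsAsymptoticBasis A.

G[_]≡_ : Pred ℤ 0ℓ → ℕ → Set
G[ A ]≡ g = IsBasisOfOrderAtMost A g × (∀ {h} → IsBasisOfOrderAtMost A h → g ℕ.≤ h)

------------------------------------------------------------------------
-- Finite sets of integers with at least two elements

-- The list may contain repetitions; they affect nothing below.

record FiniteSet≥2 : Set where
  field
    elements    : List⁺ ℤ
    nontrivial  : ∃[ x ] ∃[ y ] x ∈ₗ toList elements × y ∈ₗ toList elements × x ≢ y

  ⟦_⟧ : Pred ℤ 0ℓ
  ⟦_⟧ = _∈ₗ toList elements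

open FiniteSet≥2 public

module _ (X : FiniteSet≥2) where

  private
    x₀ = List⁺.head (elements X)
    xs = List⁺.tail (elements X)

  diam : ℕ
  diam = ℤ.∣ max x₀ xs ℤ.- min x₀ xs ∣

  differences : List ℕ
  differences =
    cartesianProductWith (λ x y → ℤ.∣ x ℤ.- y ∣) (toList (elements X)) (toList (elements X))

  δ : ℕ
  δ = foldr gcd 0 differences

  private
    ∣x-y∣≡0⇒x≡y : ∀ x y → ℤ.∣ x ℤ.- y ∣ ≡ 0 → x ≡ y
    ∣x-y∣≡0⇒x≡y x y eq = ℤ.i-j≡0⇒i≡j x y (ℤ.∣i∣≡0⇒i≡0 eq)

    ≤max : ∀ {x} → x ∈ ⟦ X ⟧ → x ℤ.≤ max x₀ xs
    ≤max (here refl) = ⊥≤max x₀ xs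
    ≤max (there x∈)  = List.lookup (xs≤max x₀ xs) x∈

    min≤ : ∀ {x} → x ∈ ⟦ X ⟧ → min x₀ xs ℤ.≤ x
    min≤ (here refl) = min≤⊤ x₀ xs
    min≤ (there x∈)  = List.lookup (min≤xs x₀ xs) x∈

    diam≢0 : diam ≢ 0
    diam≢0 eq = let x , y , x∈ , y∈ , x≢y = nontrivial X in
      x≢y (trans (collapse x∈) (sym (collapse y∈)))
      where
      collapse : ∀ {x} → x ∈ ⟦ X ⟧ → x ≡ max x₀ xs
      collapse x∈ = ℤ.≤-antisym (≤max x∈)
        (subst (ℤ._≤ _) (sym (∣x-y∣≡0⇒x≡y (max x₀ xs) (min x₀ xs) eq)) (min≤ x∈))

    gcd≡0⇒≡0 : ∀ {n} ns → foldr gcd 0 ns ≡ 0 → n ∈ₗ ns → n ≡ 0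
    gcd≡0⇒≡0 (n ∷ ns) eq (here refl) = gcd[m,n]≡0⇒m≡0 eq
    gcd≡0⇒≡0 (n ∷ ns) eq (there n∈)  = gcd≡0⇒≡0 ns (gcd[m,n]≡0⇒n≡0 n eq) n∈

    δ≢0 : δ ≢ 0
    δ≢0 eq = let x , y , x∈ , y∈ , x≢y = nontrivial X in
      x≢y (∣x-y∣≡0⇒x≡y x y (gcd≡0⇒≡0 differences eq
        (∈-cartesianProductWith⁺ (λ x y → ℤ.∣ x ℤ.- y ∣) x∈ y∈)))

  instance
    diam-nonZero : ℕ.NonZero diam
    diam-nonZero = ℕ.≢-nonZero diam≢0

    δ-nonZero : ℕ.NonZero δ
    δ-nonZero = ℕ.≢-nonZero δ≢0

  d : ℚ⁺
  d = ratio diam δ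

inverseCube : (n : ℕ) .{{_ : ℕ.NonZero n}} → ℚ⁺
inverseCube n = ratio 1 (n ℕ.^ 3) {{_}} {{ℕ.m^n≢0 n 3}}

-- Let k = ⌊h/3⌋ + 1, let B be the set of naturals congruent to 0 or 1 modulo k³, and let
-- A = B ∪ {k, k²}.  Writing residues in base k shows that A has order at most 3 (k - 1) ≤ h,
-- whereas j elements of B only reach the residues 0, …, j, so B has order k³ - 1 > h³/27.
-- The removed set {k, k²} has d = 1, as does every set with two elements.
module Submission where

open import Defs
open import Level using (0ℓ)
open import Data.Nat using (ℕ; suc; _≤_; _<_)
open import Data.Integer using (ℤ; +_)
open import Data.Rational using (_/_)
open import Relation.Unary using (Pred; _⊆_; _∖_)

open import Data.Nat using (zero; _+_; _*_; _^_; _%_; NonZero; z≤n; s≤s; s≤s⁻¹; s<s)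
  renaming (_/_ to _div_)
import Data.Nat.Properties as ℕ
open import Data.Nat.DivMod
  using (m≡m%n+[m/n]*n; m%n<n; m<n⇒m%n≡m; [m+kn]%n≡m%n; m≥n⇒m/n>0; m/n*n≤m)
open import Data.Nat.GCD using (gcd; gcd-identityˡ; gcd-identityʳ; gcd[m,n]∣m; gcd-greatest)
open import Data.Nat.Divisibility using (∣-antisym; ∣-refl)
open import Data.Nat.Induction using (<-rec)
open import Data.Nat.Tactic.RingSolver using (solve-∀)
open import Data.Integer as ℤ using (0ℤ; ∣_∣)
import Data.Integer.Properties as ℤ
open import Data.Rational as ℚ using (ℚ; 1ℚ; _÷_; toℚᵘ; Positive)
import Data.Rational.Properties as ℚ
open import Data.Rational.Unnormalised as ℚᵘ using (mkℚᵘ)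
import Data.Rational.Unnormalised.Properties as ℚᵘ
open import Data.List using (List; []; _∷_; map)
open import Data.List.Extrema ℤ.≤-totalOrder using (max; min; max≈v⁺; min≤⊤; v≤min⁺)
open import Data.List.Extrema.Nat using () renaming (max to maxℕ; xs≤max to xs≤maxℕ)
open import Data.List.NonEmpty using (_∷_)
open import Data.List.Relation.Unary.All as List using ([]; _∷_)
open import Data.List.Relation.Unary.Any using (here; there)
open import Data.List.Membership.Propositional using () renaming (_∉_ to _∉ₗ_)
open import Data.List.Membership.Propositional.Properties using (∈-map⁺)
open import Data.Vec using ([]; _∷_)
open import Data.Vec.Relation.Unary.All as Vec using ([]; _∷_)
open import Data.Product using (∃-syntax; _×_; _,_; proj₁)
open import Data.Sum using (inj₁; inj₂)
open import Relation.Nullary using (¬_; yes; no; contradiction; ¬¬-excluded-middle)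
open import Relation.Unary using (_∈_; _∪_)
open import Relation.Binary.PropositionalEquality

-- Double negation, Dedekind cuts and rational inequalities

LeastWitness≤ : (ℕ → Set) → ℕ → Set
LeastWitness≤ P n = ∃[ g ] g ≤ n × P g × (∀ {h} → P h → g ≤ h)

-- Strong induction on the witness: either a smaller one exists, or `n` is already least. For an
-- arbitrary `P` this dichotomy holds constructively only under double negation.
¬¬-least : (P : ℕ → Set) → ∀ n → P n → ¬ ¬ LeastWitness≤ P n
¬¬-least P = <-rec (λ n → P n → ¬ ¬ LeastWitness≤ P n) λ n rec Pn ¬least →
  ¬¬-excluded-middle {A = ∃[ h ] h < n × P h} λ where
    (yes (h , h<n , Ph)) → rec h<n Ph λ (g , g≤h , Pg , least) →
      ¬least (g , ℕ.≤-trans g≤h (ℕ.<⇒≤ h<n) , Pg , least)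
    (no ∄smaller) →
      ¬least (n , ℕ.≤-refl , Pn , λ {h} Ph → ℕ.≮⇒≥ λ h<n → ∄smaller (h , h<n , Ph))

-- Locatedness decides between `p` below and `r` above the cut, and the second contradicts the
-- doubly negated premise. Leaving the double negation costs the gap from `r` down to `p`.
¬¬lower⇒lower : ∀ x {p r} → p ℚ.< r → ¬ ¬ ℝ.lower x r → ℝ.lower x p
¬¬lower⇒lower x p<r ¬¬l with ℝ.located x p<r
... | inj₁ l = l
... | inj₂ u = contradiction (λ l → ℝ.disjoint x l u) ¬¬l

lower-1⋆ : ∀ q x {p} → ℚ⁺.value q ≡ 1ℚ → ℝ.lower (q ⋆ x) p → ℝ.lower x p
lower-1⋆ (mkℚ⁺ _ _) x {p} refl = subst (ℝ.lower x) (ℚ.*-identityʳ p)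

<*⇒÷< : ∀ c .{{_ : Positive c}} {p r} → p ℚ.< r ℚ.* c → (p ÷ c) {{ℚ.pos⇒nonZero c}} ℚ.< r
<*⇒÷< c {p} {r} p<rc = subst (p ℚ.* 1/c ℚ.<_) rc/c≡r (ℚ.*-monoˡ-<-pos 1/c {{ℚ.1/pos⇒pos c}} p<rc)
  where
  instance _ = ℚ.pos⇒nonZero c
  1/c = ℚ.1/ c
  rc/c≡r : r ℚ.* c ℚ.* 1/c ≡ r
  rc/c≡r = trans (ℚ.*-assoc r c 1/c) (trans (cong (r ℚ.*_) (ℚ.*-inverseʳ c)) (ℚ.*-identityʳ r))

-- In the unnormalised rationals no common factors are cancelled, so the claim becomes the
-- cross-multiplied hypothesis.
cross-≤ : ∀ {a b c e} .{{_ : NonZero b}} .{{_ : NonZero e}} →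
          a * e ≤ c * b → + a / b ℚ.≤ (+ c / 1) ℚ.* (+ 1 / e)
cross-≤ {a} {suc b} {c} {suc e} ae≤cb = ℚ.toℚᵘ-cancel-≤ (begin
  toℚᵘ (+ a / suc b)                         ≃⟨ ℚ.toℚᵘ-fromℚᵘ (mkℚᵘ (+ a) b) ⟩
  mkℚᵘ (+ a) b                               ≤⟨ ℚᵘ.*≤* ae≤cb′ ⟩
  mkℚᵘ (+ c) 0 ℚᵘ.* mkℚᵘ (+ 1) e             ≃⟨ ℚᵘ.*-cong (ℚ.toℚᵘ-fromℚᵘ (mkℚᵘ (+ c) 0))
                                                        (ℚ.toℚᵘ-fromℚᵘ (mkℚᵘ (+ 1) e)) ⟨
  toℚᵘ (+ c / 1) ℚᵘ.* toℚᵘ (+ 1 / suc e)     ≃⟨ ℚ.toℚᵘ-homo-* (+ c / 1) (+ 1 / suc e) ⟨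
  toℚᵘ ((+ c / 1) ℚ.* (+ 1 / suc e))         ∎)
  where
  open ℚᵘ.≤-Reasoning
  ae≤cb′ : + a ℤ.* (+ 1 ℤ.* + suc e) ℤ.≤ (+ c ℤ.* + 1) ℤ.* + suc b
  ae≤cb′ = subst₂ ℤ._≤_
    (trans (ℤ.pos-* a (suc e)) (cong (ℤ._*_ (+ a)) (sym (ℤ.*-identityˡ (+ suc e)))))
    (trans (ℤ.pos-* c (suc b)) (cong (ℤ._* (+ suc b)) (sym (ℤ.*-identityʳ (+ c)))))
    (ℤ.+≤+ ae≤cb)

n/n≡1 : ∀ n .{{_ : NonZero n}} → + n / n ≡ 1ℚ
n/n≡1 (suc n) = ℚ.fromℚᵘ-cong {mkℚᵘ (+ suc n) n} {mkℚᵘ (+ 1) 0} (ℚᵘ.*≡* (ℤ.*-comm (+ suc n) (+ 1)))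

-- Two-element sets have `d` equal to 1

pair : ∀ x y → x < y → FiniteSet≥2
pair x y x<y = record
  { elements   = + x ∷ + y ∷ []
  ; nontrivial = + x , + y , here refl , there (here refl) , λ where refl → ℕ.<-irrefl refl x<y
  }

-- The list of differences is 0, `D`, `D`, 0, and 0 is neutral for `gcd`.
δ≡diam : ∀ x y (x<y : x < y) → δ (pair x y x<y) ≡ diam (pair x y x<y)
δ≡diam x y x<y = begin
  gcd ∣ + x ℤ.- + x ∣ (gcd ∣ + x ℤ.- + y ∣ (gcd D (gcd ∣ + y ℤ.- + y ∣ 0)))
    ≡⟨ cong₂ gcd (cong ∣_∣ (ℤ.+-inverseʳ (+ x)))
         (cong₂ gcd (ℤ.∣i-j∣≡∣j-i∣ (+ x) (+ y)) (cong (λ z → gcd D (gcd ∣ z ∣ 0)) (ℤ.+-inverseʳ (+ y)))) ⟩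
  gcd 0 (gcd D (gcd D 0))
    ≡⟨ gcd-identityˡ _ ⟩
  gcd D (gcd D 0)
    ≡⟨ cong (gcd D) (gcd-identityʳ D) ⟩
  gcd D D
    ≡⟨ ∣-antisym (gcd[m,n]∣m D D) (gcd-greatest ∣-refl ∣-refl) ⟩
  D
    ≡⟨ cong₂ (λ u v → ∣ u ℤ.- v ∣) (max≈v⁺ (here refl) (ℤ.≤-refl ∷ []) +x≤+y) min≈⊤ ⟨
  ∣ max (+ x) (+ y ∷ []) ℤ.- min (+ x) (+ y ∷ []) ∣ ∎
  where
  open ≡-Reasoning
  D = ∣ + y ℤ.- + x ∣
  +x≤+y = ℤ.+≤+ (ℕ.<⇒≤ x<y)
  min≈⊤ : min (+ x) (+ y ∷ []) ≡ + x
  min≈⊤ = ℤ.≤-antisym (min≤⊤ (+ x) (+ y ∷ [])) (v≤min⁺ ℤ.≤-refl (+x≤+y ∷ []))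

d-pair≡1 : ∀ x y (x<y : x < y) → ℚ⁺.value (d (pair x y x<y)) ≡ 1ℚ
d-pair≡1 x y x<y = trans (ℚ./-cong {+ diam X} refl (δ≡diam x y x<y)) (n/n≡1 (diam X))
  where
  X = pair x y x<y
  instance
    _ = diam-nonZero X
    _ = δ-nonZero X

-- Building elements of sumsets

module _ {A : Pred ℤ 0ℓ} where

  sumset-∷ : ∀ {j x n} → + x ∈ A → + n ∈ (j -foldSumset A) → + (x + n) ∈ (suc j -foldSumset A)
  sumset-∷ {x = x} x∈A (as , as∈A , eq) = + x ∷ as , x∈A ∷ as∈A , cong (ℤ._+_ (+ x)) eq

  sumset-+ : ∀ i {j m n} → m ∈ (i -foldSumset A) → n ∈ (j -foldSumset A) →
             (m ℤ.+ n) ∈ ((i + j) -foldSumset A)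
  sumset-+ zero    {n = n} ([] , [] , refl) n∈ = subst (_ -foldSumset A) (sym (ℤ.+-identityˡ n)) n∈
  sumset-+ (suc i) {n = n} (a ∷ as , a∈A ∷ as∈A , refl) n∈
    with bs , bs∈A , eq ← sumset-+ i (as , as∈A , refl) n∈
    = a ∷ bs , a∈A ∷ bs∈A , trans (cong (ℤ._+_ a) eq) (sym (ℤ.+-assoc a _ n))

  -- Take `c` copies of `x` and pad with zeros to exactly `j` summands.
  multiple∈sumset : ∀ {x} → + 0 ∈ A → + x ∈ A → ∀ {c j} → c ≤ j → + (c * x) ∈ (j -foldSumset A)
  multiple∈sumset 0∈A x∈A {zero} {zero}  _         = [] , [] , refl
  multiple∈sumset 0∈A x∈A {zero} {suc j} _         = sumset-∷ 0∈A (multiple∈sumset 0∈A x∈A z≤n)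
  multiple∈sumset 0∈A x∈A {suc c}        (s≤s c≤j) = sumset-∷ x∈A (multiple∈sumset 0∈A x∈A c≤j)

exceptionsBounded : ∀ (xs : List ℤ) {n} → maxℕ 0 (map ∣_∣ xs) < n → + n ∉ₗ xs
exceptionsBounded xs max<n n∈xs =
  ℕ.<⇒≱ max<n (List.lookup (xs≤maxℕ 0 (map ∣_∣ xs)) (∈-map⁺ ∣_∣ n∈xs))

-- The naturals congruent to 0 or 1 modulo `m`, and their order

ZeroOrOneMod : ℕ → Pred ℤ 0ℓ
ZeroOrOneMod m a = ∃[ ε ] ∃[ q ] ε ≤ 1 × a ≡ + (ε + q * m)

-- Each summand contributes at most 1 to `t`. The value `t` is not reduced modulo `m`; it is a
-- residue only once `j` is below `m`.
sum-ZeroOrOneMod : ∀ {m} j {n} → n ∈ (j -foldSumset ZeroOrOneMod m) →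
                   ∃[ t ] ∃[ q ] t ≤ j × n ≡ + (t + q * m)
sum-ZeroOrOneMod zero ([] , [] , refl) = 0 , 0 , z≤n , refl
sum-ZeroOrOneMod {m} (suc j) (_ ∷ as , (ε , q , ε≤1 , refl) ∷ as∈ , refl)
  with t , r , t≤j , eq ← sum-ZeroOrOneMod j (as , as∈ , refl)
  = ε + t , q + r , ℕ.+-mono-≤ ε≤1 t≤j ,
    trans (cong (ℤ._+_ (+ (ε + q * m))) eq) (cong +_ (regroup ε q t r m))
  where
  regroup : ∀ ε q t r m → (ε + q * m) + (t + r * m) ≡ (ε + t) + (q + r) * m
  regroup = solve-∀

module _ {A : Pred ℤ 0ℓ} {m : ℕ} (ZeroOrOneMod⊆A : ZeroOrOneMod m ⊆ A) where

  -- The first summand carries the whole multiple `q * m`, together with one unit if `a` is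
  -- positive; the other summands are ones and padding zeros. Hence at least one summand is
  -- required.
  smallResidue∈sumset : ∀ {a j} q → 0 < j → a ≤ j → + (a + q * m) ∈ (j -foldSumset A)
  smallResidue∈sumset {zero} {suc j} q _ _ =
    subst (suc j -foldSumset A) (cong +_ (ℕ.+-identityʳ (q * m)))
      (sumset-∷ {A} {j} (ZeroOrOneMod⊆A (0 , q , z≤n , refl)) (multiple∈sumset 0∈A 0∈A z≤n))
    where 0∈A = ZeroOrOneMod⊆A (0 , 0 , z≤n , refl)
  smallResidue∈sumset {suc a} {suc j} q _ (s≤s a≤j) =
    subst (suc j -foldSumset A) (cong +_ (regroup a (q * m)))
      (sumset-∷ {A} {j} (ZeroOrOneMod⊆A (1 , q , ℕ.≤-refl , refl)) (multiple∈sumset 0∈A 1∈A a≤j))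
    where
    0∈A = ZeroOrOneMod⊆A (0 , 0 , z≤n , refl)
    1∈A = ZeroOrOneMod⊆A (1 , 0 , ℕ.≤-refl , refl)
    regroup : ∀ a M → (1 + M) + a * 1 ≡ suc a + M
    regroup = solve-∀

-- All residues modulo `g + 1` are at most `g`, so `g` summands suffice, and residue `g` forces that
-- many. Two inclusions stand in for equality of sets because `A ∖ ⟦ X ⟧` agrees with `B` only up to
-- logical equivalence.
G-ZeroOrOneMod : ∀ {A g} → 0 < g → ZeroOrOneMod (suc g) ⊆ A → A ⊆ ZeroOrOneMod (suc g) → G[ A ]≡ g
G-ZeroOrOneMod {A} {g} 0<g ⊆A A⊆ = (0<g , [] , all∈) , least
  where
  m = suc g

  all∈ : ∀ n → 0ℤ ℤ.≤ n → n ∉ₗ [] → n ∈ (g -foldSumset A)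
  all∈ (+ n) _ _ = subst (λ n → + n ∈ (g -foldSumset A)) (sym (m≡m%n+[m/n]*n n m))
    (smallResidue∈sumset ⊆A (n div m) 0<g (s≤s⁻¹ (m%n<n n m)))

  -- A large n ≡ g (mod g + 1) is not a sum of fewer than g elements.
  least : ∀ {h} → IsBasisOfOrderAtMost A h → g ≤ h
  least {h} (_ , xs , almostAll) =
    let as , as∈A , eq = almostAll (+ (g + N * m)) (ℤ.+≤+ z≤n) (exceptionsBounded xs N≤n)
        t , q , t≤h , eq′ = sum-ZeroOrOneMod h (as , Vec.map A⊆ as∈A , eq)
    in ℕ.≮⇒≥ λ h<g → let t<g = ℕ.≤-<-trans t≤h h<g in ℕ.<-irrefl (t≡g t q eq′ t<g) t<g
    where
    -- `N` exceeds the absolute value of every exception, and so does `g + N * m`, since `m` is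
    -- positive.
    N = suc (maxℕ 0 (map ∣_∣ xs))
    N≤n : N ≤ g + N * m
    N≤n = ℕ.≤-trans (ℕ.m≤m*n N m) (ℕ.m≤n+m (N * m) g)
    open ≡-Reasoning
    t≡g : ∀ t q → + (g + N * m) ≡ + (t + q * m) → t < g → t ≡ g
    t≡g t q eq t<g = begin
      t                 ≡⟨ m<n⇒m%n≡m (ℕ.m<n⇒m<1+n t<g) ⟨
      t % m             ≡⟨ [m+kn]%n≡m%n t q m ⟨
      (t + q * m) % m   ≡⟨ cong (_% m) (ℤ.+-injective eq) ⟨
      (g + N * m) % m   ≡⟨ [m+kn]%n≡m%n g N m ⟩
      g % m             ≡⟨ m<n⇒m%n≡m (ℕ.n<1+n g) ⟩
      g                 ∎

-- An element with quotient 0 is at most 1, and any other is at least `m`. This keeps `k` and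
-- `k * k` outside `B`.
∉ZeroOrOneMod : ∀ {x m} → 1 < x → x < m → ¬ (+ x ∈ ZeroOrOneMod m)
∉ZeroOrOneMod 1<x x<m (ε , zero  , ε≤1 , refl) = ℕ.<⇒≱ 1<x (subst (_≤ 1) (sym (ℕ.+-identityʳ ε)) ε≤1)
∉ZeroOrOneMod {m = m} 1<x x<m (ε , suc q , ε≤1 , refl) =
  ℕ.<⇒≱ x<m (ℕ.≤-trans (ℕ.m≤m+n m (q * m)) (ℕ.m≤n+m (m + q * m) ε))

-- The extremal basis and the removed pair

module Extremal (K : ℕ) (0<K : 0 < K) where

  -- `K` is the largest digit in base `k`. The geometric sum writes k³ - 1 without truncated
  -- subtraction and gives the modulus the form `suc g` used in `G-ZeroOrOneMod`.
  k g m : ℕ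
  k = suc K
  g = K * (1 + k + k * k)
  m = suc g

  m≡k³ : m ≡ k * (k * k)
  m≡k³ = identity K
    where
    identity : ∀ K → suc (K * (1 + suc K + suc K * suc K)) ≡ suc K * (suc K * suc K)
    identity = solve-∀

  1<k : 1 < k
  1<k = s<s 0<K

  k<k² : k < k * k
  k<k² = ℕ.m<m*n k k 1<k

  k²<m : k * k < m
  k²<m = subst (k * k <_) (trans (ℕ.*-comm (k * k) k) (sym m≡k³)) (ℕ.m<m*n (k * k) k 1<k)

  X : FiniteSet≥2
  X = pair k (k * k) k<k²

  B A : Pred ℤ 0ℓ
  B = ZeroOrOneMod m
  A = B ∪ ⟦ X ⟧

  noNegatives : FinitelyManyNegatives A
  noNegatives = [] , λ where
    (inj₁ (_ , _ , _ , refl)) (ℤ.+<+ ())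
    (inj₂ (here refl)) (ℤ.+<+ ())
    (inj₂ (there (here refl))) (ℤ.+<+ ())

  -- Each of the three blocks of `K` summands pays for one base-`k` digit. The lowest digit is
  -- produced inside `B` along with the multiple of `m`; the other two count copies of `k` and
  -- `k * k`, padded with 0.
  A-basis : IsBasisOfOrderAtMost A (K + (K + K))
  A-basis = ℕ.<-≤-trans 0<K (ℕ.m≤m+n K (K + K)) , [] , all∈
    where
    0∈A : + 0 ∈ A
    0∈A = inj₁ (0 , 0 , z≤n , refl)

    digit≤K : ∀ n → n % k ≤ K
    digit≤K n = s≤s⁻¹ (m%n<n n k)

    regroup : ∀ a b c q k →
      a + (b + (c + q * k) * k) * k ≡ (a + q * (k * (k * k))) + (b * k + c * (k * k))
    regroup = solve-∀

    all∈ : ∀ n → 0ℤ ℤ.≤ n → n ∉ₗ [] → n ∈ ((K + (K + K)) -foldSumset A)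
    all∈ (+ n) _ _ = subst (λ n → + n ∈ ((K + (K + K)) -foldSumset A)) (sym expansion)
      (sumset-+ K (smallResidue∈sumset {A} {m} inj₁ q 0<K (digit≤K n))
        (sumset-+ K (multiple∈sumset 0∈A (inj₂ (here refl)) (digit≤K n₁))
                    (multiple∈sumset 0∈A (inj₂ (there (here refl))) (digit≤K n₂))))
      where
      n₁ = n div k
      n₂ = n₁ div k
      a = n % k
      b = n₁ % k
      c = n₂ % k
      q = n₂ div k
      open ≡-Reasoning
      expansion : n ≡ (a + q * m) + (b * k + c * (k * k))
      expansion = begin
        n                                   ≡⟨ m≡m%n+[m/n]*n n k ⟩
        a + n₁ * k                          ≡⟨ cong (λ z → a + z * k) (m≡m%n+[m/n]*n n₁ k) ⟩
        a + (b + n₂ * k) * k                ≡⟨ cong (λ z → a + (b + z * k) * k) (m≡m%n+[m/n]*n n₂ k) ⟩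
        a + (b + (c + q * k) * k) * k       ≡⟨ regroup a b c q k ⟩
        (a + q * (k * (k * k))) + (b * k + c * (k * k))
          ≡⟨ cong (λ z → (a + q * z) + (b * k + c * (k * k))) m≡k³ ⟨
        (a + q * m) + (b * k + c * (k * k)) ∎

  B⊆A∖X : B ⊆ A ∖ ⟦ X ⟧
  B⊆A∖X b∈B = inj₁ b∈B , λ where
    (here refl)         → ∉ZeroOrOneMod 1<k (ℕ.<-trans k<k² k²<m) b∈B
    (there (here refl)) → ∉ZeroOrOneMod (ℕ.<-trans 1<k k<k²) k²<m b∈B

  A∖X⊆B : A ∖ ⟦ X ⟧ ⊆ B
  A∖X⊆B (inj₁ b∈B , _)   = b∈B
  A∖X⊆B (inj₂ x∈X , x∉X) = contradiction x∈X x∉X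

  G-A∖X : G[ A ∖ ⟦ X ⟧ ]≡ g
  G-A∖X = G-ZeroOrOneMod (ℕ.<-≤-trans 0<K (ℕ.m≤m*n K (1 + k + k * k))) B⊆A∖X A∖X⊆B

  -- With `K = suc L`, the right side exceeds (3K + 2)³ by a polynomial in `L` with positive
  -- coefficients. Positivity of `K` matters: at 0 the bound would read 8 ≤ 0.
  h³≤27g : ∀ {h} → h ≤ 2 + K * 3 → h ^ 3 ≤ 27 * g
  h³≤27g {h} h≤ = ℕ.≤-trans (ℕ.^-monoˡ-≤ 3 h≤) (bound K 0<K)
    where
    identity : ∀ L → let h = 5 + L * 3 in
                     h * (h * (h * 1)) + (27 * (L * L) + 99 * L + 64)
                     ≡ 27 * (suc L * (1 + suc (suc L) + suc (suc L) * suc (suc L)))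
    identity = solve-∀
    bound : ∀ K → 0 < K → (2 + K * 3) ^ 3 ≤ 27 * (K * (1 + suc K + suc K * suc K))
    bound (suc L) _ = ℕ.≤-trans (ℕ.m≤m+n _ _) (ℕ.≤-reflexive (identity L))

theorem1p2 : (f : ℕ → ℝ) →
    (∀ (h : ℕ) → 0 < h →
    ∀ (A : Pred ℤ 0ℓ) → FinitelyManyNegatives A →
    ∀ (g : ℕ) → G[ A ]≡ g → g ≤ h →
    ∀ (X : FiniteSet≥2) → ⟦ X ⟧ ⊆ A → IsAsymptoticBasis (A ∖ ⟦ X ⟧) →
    ∀ (g′ : ℕ) → G[ A ∖ ⟦ X ⟧ ]≡ g′ → fromℕ g′ ≤ᴿ d X ⋆ f h) →
    fromℝ (fromℚ (+ 1 / 27)) ≤∞ liminf (λ n → inverseCube (suc n) ⋆ f (suc n))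
theorem1p2 f bound {p} p<1/27 =
  -- Two margins are spent: `r` above `p` is the one built into `inf`, and `s` above `r` pays for
  -- removing the double negation.
  let r , p<r , r<1/27 = ℚ.<-dense p<1/27
      s , r<s , s<1/27 = ℚ.<-dense r<1/27
  -- From index 2 on, `h = suc n` is at least 3, so `K = h div 3` is positive.
  in 2 , r , p<r , λ (n , 2≤n) →
       ¬¬lower⇒lower (inverseCube (suc n) ⋆ f (suc n)) r<s (¬¬lower n 2≤n s<1/27)
  where
  -- The order of A exists only up to double negation.
  ¬¬lower : ∀ n → 2 ≤ n → ∀ {s} → s ℚ.< + 1 / 27 →
            ¬ ¬ ℝ.lower (inverseCube (suc n) ⋆ f (suc n)) s
  ¬¬lower n 2≤n {s} s<1/27 ¬lower =
    ¬¬-least (IsBasisOfOrderAtMost A) (K + (K + K)) A-basis λ (gA , gA≤3K , basis , least) →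
      -- By the definition of `⋆`, the goal is that `s ÷ c` lies in the lower cut of `f h`, where
      -- `c` is 1/h³. The assumed bound on `g` is used at this point, which is below `g` because s <
      -- 1/27 ≤ g c.
      ¬lower (lower-1⋆ (d X) (f h) (d-pair≡1 k (k * k) k<k²)
        (bound h (s≤s z≤n) A noNegatives gA (basis , least) (ℕ.≤-trans gA≤3K 3K≤h)
          X inj₂ (g , proj₁ G-A∖X) g G-A∖X s/c<g))
    where
    h = suc n
    K = h div 3
    0<K = m≥n⇒m/n>0 {h} {3} (s≤s 2≤n)
    open Extremal K 0<K
    c = inverseCube h

    3K≤h : K + (K + K) ≤ h
    3K≤h = subst (_≤ h) (triple K) (m/n*n≤m h 3)
      where
      triple : ∀ K → K * 3 ≡ K + (K + K)
      triple = solve-∀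

    h≤2+3K : h ≤ 2 + K * 3
    h≤2+3K = subst (_≤ 2 + K * 3) (sym (m≡m%n+[m/n]*n h 3)) (ℕ.+-monoˡ-≤ (K * 3) (s≤s⁻¹ (m%n<n h 3)))

    instance
      h³≢0 : NonZero (h ^ 3)
      h³≢0 = ℕ.m^n≢0 h 3

    1/27≤g*c : + 1 / 27 ℚ.≤ (+ g / 1) ℚ.* ℚ⁺.value c
    1/27≤g*c = cross-≤ {1} {27} {g} {h ^ 3}
      (subst₂ _≤_ (sym (ℕ.*-identityˡ (h ^ 3))) (ℕ.*-comm 27 g) (h³≤27g h≤2+3K))

    s/c<g = <*⇒÷< (ℚ⁺.value c) {{ℚ⁺.positive c}} {s} {+ g / 1} (ℚ.<-≤-trans s<1/27 1/27≤g*c)
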